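{- (Soundness of the classical-style semantics.) For any statement $s$, state $\sigma$ and classical-style resumption $r:\mathit{res}_{\mathrm c}$, if $(s,\sigma)\Rightarrow_{\mathrm c}r$, then there exists a (delayful) resumption $r':\mathit{res}$ such that $(s,\sigma)\Rightarrow r'$ and $\mathit{emb}~r\cong r'$.
   Context: Language. Given sets of variables $x$ and pure expressions $e$; values are integers; states $\sigma$ map variables to integers; $\sigma[x\mapsto v]$ is state update; $\llbracket e\rrbracket\sigma\in\mathbb Z$ is the value of $e$ in $\sigma$; $\sigma\models e$ means $\llbracket e\rrbracket\sigma\neq 0$. Statements: $s::=\mathsf{skip}\mid s_0;s_1\mid x:=e\mid\mathsf{if}~e~\mathsf{then}~s_t~\mathsf{else}~s_f\mid\mathsf{while}~e~\mathsf{do}~s_t\mid\mathsf{input}~x\mid\mathsf{output}~e$. Delayful resumptions $r:\mathit{res}$ are defined coinductively by the constructors $\mathit{ret}~\sigma$, $\mathit{in}~f$ ($f:\mathbb Z\to\mathit{res}$), $\mathit{out}~v~r$ ($v\in\mathbb Z$), $\delta~r$. Strong bisimilarity $\approx$ is defined coinductively: $\mathit{ret}~\sigma\approx\mathit{ret}~\sigma$; $\mathit{in}~f\approx\mathit{in}~f_*$ if $\forall v.\,f\,v\approx f_*\,v$; $\mathit{out}~v~r\approx\mathit{out}~v~r_*$ if $r\approx r_*$; $\delta~r\approx\delta~r_*$ if $r\approx r_*$. Classical-style resumptions $r:\mathit{res}_{\mathrm c}$ are defined coinductively by constructors $\mathit{ret}_{\mathrm c}~\sigma$, $\mathit{in}_{\mathrm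 c}~f$ ($f:\mathbb Z\to\mathit{res}_{\mathrm c}$), $\mathit{out}_{\mathrm c}~v~r$ ($v\in\mathbb Z$), and the constant $\bullet$ (silent divergence), with strong bisimilarity $\approx$ defined coinductively by the analogous congruence rules and $\bullet\approx\bullet$. Strongly bisimilar resumptions count as equal (setoids with equality $\approx$), and all relations on resumptions are understood to respect $\approx$. The embedding $\mathit{emb}:\mathit{res}_{\mathrm c}\to\mathit{res}$ is defined corecursively: $\mathit{emb}(\mathit{ret}_{\mathrm c}~\sigma)=\mathit{ret}~\sigma$, $\mathit{emb}(\mathit{in}_{\mathrm c}~f)=\mathit{in}(\lambda v.\,\mathit{emb}(f\,v))$, $\mathit{emb}(\mathit{out}_{\mathrm c}~v~r)=\mathit{out}~v~(\mathit{emb}~r)$, $\mathit{emb}~\bullet=\delta(\mathit{emb}~\bullet)$. Convergence $r\downarrow r'$ on $\mathit{res}$ is inductive: $\mathit{ret}~\sigma\downarrow\mathit{ret}~\sigma$; $\mathit{in}~f\downarrow\mathit{in}~f_*$ if $\forall v.\,f\,v\approx f_*\,v$; $\mathit{out}~v~r\downarrow\mathit{out}~v~r_*$ if $r\approx r_*$; $\delta~r\downarrow r'$ if $r\downarrow r'$. Weak bisimilarity $r\cong r_*$ on $\mathit{res}$ is coinductive: (1) $r\cong r_*$ if $r\downarrow\mathit{ret}~\sigma$ and $r_*\downarrow\mathit{ret}~\sigma$; (2) $r\cong r_*$ if $r\downarrow\mathit{in}~f$, $r_*\downarrow\mathit{in}~f_*$ and $\forall v.\,f\,v\cong f_*\,v$;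 (3) $r\cong r_*$ if $r\downarrow\mathit{out}~v~r'$, $r_*\downarrow\mathit{out}~v~r_*'$ and $r'\cong r'_*$; (4) $\delta~r\cong\delta~r_*$ if $r\cong r_*$. Delayful big-step semantics. Evaluation $(s,\sigma)\Rightarrow r$ and its extended evaluation, written here $(s,r)\Rightarrow^{\mathrm{ext}}r'$ (on $\mathit{res}$), are defined mutually coinductively by: $(x:=e,\sigma)\Rightarrow\delta(\mathit{ret}~\sigma[x\mapsto\llbracket e\rrbracket\sigma])$; $(\mathsf{skip},\sigma)\Rightarrow\mathit{ret}~\sigma$; $(s_0;s_1,\sigma)\Rightarrow r'$ if $(s_0,\sigma)\Rightarrow r$ and $(s_1,r)\Rightarrow^{\mathrm{ext}}r'$; $(\mathsf{if}~e~\mathsf{then}~s_t~\mathsf{else}~s_f,\sigma)\Rightarrow r$ if either $\sigma\models e$ and $(s_t,\delta(\mathit{ret}~\sigma))\Rightarrow^{\mathrm{ext}}r$, or $\sigma\not\models e$ and $(s_f,\delta(\mathit{ret}~\sigma))\Rightarrow^{\mathrm{ext}}r$; $(\mathsf{while}~e~\mathsf{do}~s_t,\sigma)\Rightarrow r'$ if $\sigma\models e$, $(s_t,\delta(\mathit{ret}~\sigma))\Rightarrow^{\mathrm{ext}}r$ and $(\mathsf{while}~e~\mathsf{do}~s_t,r)\Rightarrow^{\mathrm{ext}}r'$; $(\mathsf{while}~e~\mathsf{do}~s_t,\sigma)\Rightarrow\delta(\mathit{ret}~\sigma)$ if $\sigma\not\models e$; $(\mathsf{input}~x,\sigma)\Rightarrow\mathit{in}(\lambda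 v.\,\mathit{ret}~\sigma[x\mapsto v])$; $(\mathsf{output}~e,\sigma)\Rightarrow\mathit{out}~(\llbracket e\rrbracket\sigma)~(\mathit{ret}~\sigma)$; $(s,\mathit{ret}~\sigma)\Rightarrow^{\mathrm{ext}}r$ if $(s,\sigma)\Rightarrow r$; $(s,\mathit{in}~f)\Rightarrow^{\mathrm{ext}}\mathit{in}~f'$ if $\forall v.\,(s,f\,v)\Rightarrow^{\mathrm{ext}}f'\,v$; $(s,\mathit{out}~v~r)\Rightarrow^{\mathrm{ext}}\mathit{out}~v~r'$ if $(s,r)\Rightarrow^{\mathrm{ext}}r'$; $(s,\delta~r)\Rightarrow^{\mathrm{ext}}\delta~r'$ if $(s,r)\Rightarrow^{\mathrm{ext}}r'$. Classical-style big-step semantics. Let $X$ be a relation between pairs (statement, classical-style resumption) and classical-style resumptions, written $(s,r)\mathbin X r'$. The convergent evaluation $(s,\sigma)\mathbin{{\Rightarrow}{\downarrow}(X)}r$ ($r:\mathit{res}_{\mathrm c}$), abbreviated $(s,\sigma)\Downarrow_X r$, is defined inductively: $(x:=e,\sigma)\Downarrow_X\mathit{ret}_{\mathrm c}(\sigma[x\mapsto\llbracket e\rrbracket\sigma])$; $(\mathsf{skip},\sigma)\Downarrow_X\mathit{ret}_{\mathrm c}~\sigma$; $(s_0;s_1,\sigma)\Downarrow_X r$ if $(s_0,\sigma)\Downarrow_X\mathit{ret}_{\mathrm c}~\sigma'$ and $(s_1,\sigma')\Downarrow_X r$; $(s_0;s_1,\sigma)\Downarrow_X\mathit{in}_{\mathrm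 c}~f'$ if $(s_0,\sigma)\Downarrow_X\mathit{in}_{\mathrm c}~f$ and $\forall v.\,(s_1,f\,v)\mathbin X f'\,v$; $(s_0;s_1,\sigma)\Downarrow_X\mathit{out}_{\mathrm c}~v~r'$ if $(s_0,\sigma)\Downarrow_X\mathit{out}_{\mathrm c}~v~r$ and $(s_1,r)\mathbin X r'$; $(\mathsf{if}~e~\mathsf{then}~s_t~\mathsf{else}~s_f,\sigma)\Downarrow_X r$ if $\sigma\models e$ and $(s_t,\sigma)\Downarrow_X r$, or $\sigma\not\models e$ and $(s_f,\sigma)\Downarrow_X r$; with $w=\mathsf{while}~e~\mathsf{do}~s_t$: $(w,\sigma)\Downarrow_X r$ if $\sigma\models e$, $(s_t,\sigma)\Downarrow_X\mathit{ret}_{\mathrm c}~\sigma'$ and $(w,\sigma')\Downarrow_X r$; $(w,\sigma)\Downarrow_X\mathit{in}_{\mathrm c}~f'$ if $\sigma\models e$, $(s_t,\sigma)\Downarrow_X\mathit{in}_{\mathrm c}~f$ and $\forall v.\,(w,f\,v)\mathbin X f'\,v$; $(w,\sigma)\Downarrow_X\mathit{out}_{\mathrm c}~v~r'$ if $\sigma\models e$, $(s_t,\sigma)\Downarrow_X\mathit{out}_{\mathrm c}~v~r$ and $(w,r)\mathbin X r'$; $(w,\sigma)\Downarrow_X\mathit{ret}_{\mathrm c}~\sigma$ if $\sigma\not\models e$; $(\mathsf{input}~x,\sigma)\Downarrow_X\mathit{in}_{\mathrm c}(\lambda v.\,\mathit{ret}_{\mathrm c}~\sigma[x\mapsto v])$;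 $(\mathsf{output}~e,\sigma)\Downarrow_X\mathit{out}_{\mathrm c}~(\llbracket e\rrbracket\sigma)~(\mathit{ret}_{\mathrm c}~\sigma)$. The divergent evaluation $(s,\sigma)~{\Rightarrow}{\uparrow}(X)$, abbreviated $(s,\sigma)\Uparrow_X$, is defined coinductively: $(s_0;s_1,\sigma)\Uparrow_X$ if $(s_0,\sigma)\Uparrow_X$, or if $(s_0,\sigma)\Downarrow_X\mathit{ret}_{\mathrm c}~\sigma'$ and $(s_1,\sigma')\Uparrow_X$; $(\mathsf{if}~e~\mathsf{then}~s_t~\mathsf{else}~s_f,\sigma)\Uparrow_X$ if $\sigma\models e$ and $(s_t,\sigma)\Uparrow_X$, or $\sigma\not\models e$ and $(s_f,\sigma)\Uparrow_X$; $(\mathsf{while}~e~\mathsf{do}~s_t,\sigma)\Uparrow_X$ if $\sigma\models e$ and $(s_t,\sigma)\Uparrow_X$, or if $\sigma\models e$, $(s_t,\sigma)\Downarrow_X\mathit{ret}_{\mathrm c}~\sigma'$ and $(\mathsf{while}~e~\mathsf{do}~s_t,\sigma')\Uparrow_X$. Extended evaluation $(s,r)\stackrel{*}{\Rightarrow}r'$ on $\mathit{res}_{\mathrm c}$ is the coinductively defined (greatest) relation with rules: $(s,\mathit{ret}_{\mathrm c}~\sigma)\stackrel{*}{\Rightarrow}r$ if there is $X\subseteq{\stackrel{*}{\Rightarrow}}$ with $(s,\sigma)\Downarrow_X r$; $(s,\mathit{ret}_{\mathrm c}~\sigma)\stackrel{*}{\Rightarrow}\bullet$ if there is $X\subseteq{\stackrel{*}{\Rightarrow}}$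 with $(s,\sigma)\Uparrow_X$; $(s,\mathit{in}_{\mathrm c}~f)\stackrel{*}{\Rightarrow}\mathit{in}_{\mathrm c}~f'$ if $\forall v.\,(s,f\,v)\stackrel{*}{\Rightarrow}f'\,v$; $(s,\mathit{out}_{\mathrm c}~v~r)\stackrel{*}{\Rightarrow}\mathit{out}_{\mathrm c}~v~r'$ if $(s,r)\stackrel{*}{\Rightarrow}r'$; $(s,\bullet)\stackrel{*}{\Rightarrow}\bullet$. Finally, $(s,\sigma)\Rightarrow_{\mathrm c}r$ if $(s,\sigma)\mathbin{{\Rightarrow}{\downarrow}({\stackrel{*}{\Rightarrow}})}r$, and $(s,\sigma)\Rightarrow_{\mathrm c}\bullet$ if $(s,\sigma)~{\Rightarrow}{\uparrow}({\stackrel{*}{\Rightarrow}})$ (these are the only two rules). -}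

module Defs where

open import Data.Integer.Base using (ℤ; 0ℤ)
open import Data.List.Base using (List; []; _∷_)
open import Data.Product.Base using (_×_; ∃₂; ∃-syntax)
open import Data.Unit.Base using (⊤; tt)
open import Level using (Level; 0ℓ; _⊔_) renaming (suc to lsuc)
open import Relation.Binary.Definitions using (DecidableEquality)
open import Relation.Binary.PropositionalEquality.Core using (_≢_)
open import Relation.Nullary.Decidable.Core using (yes; no)
open import Relation.Nullary.Negation.Core using (¬_)

-- Variables and expressions are arbitrary given sets.  Equality of variables
-- is decidable because state update needs it.
record Language : Set₁ where
  field
    Var  : Set
    _≟_  : DecidableEquality Var
    Expr : Set
    ⟦_⟧_ : Expr → (Var → ℤ) → ℤ

module Semantics (L : Language) where

  open Language L public

  State : Set
  State = Var → ℤ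

  _[_↦_] : State → Var → ℤ → State
  (σ [ x ↦ v ]) y with y ≟ x
  ... | yes _ = v
  ... | no  _ = σ y

  infix 4 _⊨_ _⊭_

  _⊨_ : State → Expr → Set
  σ ⊨ e = ⟦ e ⟧ σ ≢ 0ℤ

  _⊭_ : State → Expr → Set
  σ ⊭ e = ¬ (σ ⊨ e)

  infixr 5 _⨾_
  infix  6 _≔_ if_then_else_ while_loop_

  data Stmt : Set where
    skip          : Stmt
    _⨾_           : Stmt → Stmt → Stmt
    _≔_           : Var → Expr → Stmt
    if_then_else_ : Expr → Stmt → Stmt → Stmt
    while_loop_   : Expr → Stmt → Stmt
    input         : Var → Stmt
    output        : Expr → Stmt

  ----------------------------------------------------------------------
  -- Conventions for coinduction
  --
  -- Native guarded corecursion needs an infective option; to avoid it, the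
  -- coinductive definitions are spelled out.
  --
  -- Types.  A coinductive type is the final coalgebra of its signature
  -- functor F.  A possibly infinite tree is the function sending a path to
  -- the shape (an element of F ⊤) of the node at its end.  A path is a list
  -- of integers: under an input node an entry is the value read; under a
  -- node with a single child all entries should lead to the same child, and
  -- 'observe' follows 0ℤ; labels below a leaf are irrelevant.  Functions
  -- with the same relevant labels are identified by strong bisimilarity,
  -- which is the equality of resumptions.
  --
  -- Relations.  A coinductive relation is the greatest relation supported by
  -- its rules: objects are related if they are related by some R each of
  -- whose instances is the conclusion of a rule with premises in R.  Since
  -- relations on resumptions respect strong bisimilarity, 'conclusion' is
  -- read up to strong bisimilarity, and an inductive relation on resumptions
  -- gets one extra rule 'resp'.
  --
  -- Levels.  Strong bisimilarity is Set₁-valued, so the other definitions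
  -- quantify over Set₁-valued relations on resumptions.  Larger ones would
  -- not give larger greatest fixed points, because a derivation has only a
  -- small set of nodes.

  ----------------------------------------------------------------------
  -- Delayful resumptions

  data ResF (A : Set) : Set where
    ret : State → ResF A
    inp : (ℤ → A) → ResF A
    out : ℤ → A → ResF A
    δ   : A → ResF A

  Res : Set
  Res = List ℤ → ResF ⊤

  observe : Res → ResF Res
  observe t with t []
  ... | ret σ   = ret σ
  ... | inp _   = inp (λ v p → t (v ∷ p))
  ... | out v _ = out v (λ p → t (0ℤ ∷ p))
  ... | δ _     = δ (λ p → t (0ℤ ∷ p))

  -- Resumptions are built as ⟨ ret σ ⟩, ⟨ inp f ⟩, ⟨ out v r ⟩ and ⟨ δ r ⟩.
  ⟨_⟩ : ResF Res → Res
  ⟨ ret σ ⟩   _       = ret σ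
  ⟨ inp f ⟩   []      = inp (λ _ → tt)
  ⟨ inp f ⟩   (v ∷ p) = f v p
  ⟨ out v r ⟩ []      = out v tt
  ⟨ out v r ⟩ (_ ∷ p) = r p
  ⟨ δ r ⟩     []      = δ tt
  ⟨ δ r ⟩     (_ ∷ p) = r p

  -- Corecursion: unfold c x is ⟨ c x ⟩ with unfold c applied to the children.
  module _ {A : Set} (c : A → ResF A) where

    unfold     : A → Res
    unfoldStep : ResF A → Res

    unfold x p = unfoldStep (c x) p

    unfoldStep (ret σ)   _       = ret σ
    unfoldStep (inp f)   []      = inp (λ _ → tt)
    unfoldStep (inp f)   (v ∷ p) = unfold (f v) p
    unfoldStep (out v x) []      = out v tt
    unfoldStep (out v x) (_ ∷ p) = unfold x p
    unfoldStep (δ x)     []      = δ tt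
    unfoldStep (δ x)     (_ ∷ p) = unfold x p

  data Bisim (R : Res → Res → Set) : ResF Res → ResF Res → Set where
    ret : ∀ {σ} → Bisim R (ret σ) (ret σ)
    inp : ∀ {f f*} → (∀ v → R (f v) (f* v)) → Bisim R (inp f) (inp f*)
    out : ∀ {v r r*} → R r r* → Bisim R (out v r) (out v r*)
    δ   : ∀ {r r*} → R r r* → Bisim R (δ r) (δ r*)

  infix 4 _≈_ _↓_ _≅_

  _≈_ : Res → Res → Set₁
  r ≈ r* = ∃[ R ] (∀ {x y} → R x y → Bisim R (observe x) (observe y)) × R r r*

  data _↓_ : Res → Res → Set₁ where
    ret  : ∀ {σ} → ⟨ ret σ ⟩ ↓ ⟨ ret σ ⟩
    inp  : ∀ {f f*} → (∀ v → f v ≈ f* v) → ⟨ inp f ⟩ ↓ ⟨ inp f* ⟩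
    out  : ∀ {v r r*} → r ≈ r* → ⟨ out v r ⟩ ↓ ⟨ out v r* ⟩
    δ    : ∀ {r r′} → r ↓ r′ → ⟨ δ r ⟩ ↓ r′
    resp : ∀ {r r₁ r′ r₁′} → r ≈ r₁ → r′ ≈ r₁′ → r₁ ↓ r₁′ → r ↓ r′

  data WeakBisim (R : Res → Res → Set₁) : Res → Res → Set₁ where
    ret : ∀ {r r* σ} → r ↓ ⟨ ret σ ⟩ → r* ↓ ⟨ ret σ ⟩ → WeakBisim R r r*
    inp : ∀ {r r* f f*} → r ↓ ⟨ inp f ⟩ → r* ↓ ⟨ inp f* ⟩ →
          (∀ v → R (f v) (f* v)) → WeakBisim R r r*
    out : ∀ {r r* v r′ r*′} → r ↓ ⟨ out v r′ ⟩ → r* ↓ ⟨ out v r*′ ⟩ →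
          R r′ r*′ → WeakBisim R r r*
    δ   : ∀ {r r*} → R r r* → WeakBisim R ⟨ δ r ⟩ ⟨ δ r* ⟩

  _≅_ : Res → Res → Set₂
  r ≅ r* = ∃[ R ]
    (∀ {x y} → R x y → ∃₂ λ x₁ y₁ → x ≈ x₁ × y ≈ y₁ × WeakBisim R x₁ y₁) ×
    R r r*

  ----------------------------------------------------------------------
  -- Delayful big-step semantics

  EvalRel ExtRel : Set₂
  EvalRel = Stmt → State → Res → Set₁
  ExtRel  = Stmt → Res → Res → Set₁

  data EvalRule (E : EvalRel) (E* : ExtRel) : EvalRel where
    assign  : ∀ {x e σ} →
              EvalRule E E* (x ≔ e) σ ⟨ δ ⟨ ret (σ [ x ↦ ⟦ e ⟧ σ ]) ⟩ ⟩
    skip    : ∀ {σ} → EvalRule E E* skip σ ⟨ ret σ ⟩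
    seq     : ∀ {s₀ s₁ σ r r′} → E s₀ σ r → E* s₁ r r′ →
              EvalRule E E* (s₀ ⨾ s₁) σ r′
    if-tt   : ∀ {e sₜ s_f σ r} → σ ⊨ e → E* sₜ ⟨ δ ⟨ ret σ ⟩ ⟩ r →
              EvalRule E E* (if e then sₜ else s_f) σ r
    if-ff   : ∀ {e sₜ s_f σ r} → σ ⊭ e → E* s_f ⟨ δ ⟨ ret σ ⟩ ⟩ r →
              EvalRule E E* (if e then sₜ else s_f) σ r
    loop-tt : ∀ {e sₜ σ r r′} → σ ⊨ e → E* sₜ ⟨ δ ⟨ ret σ ⟩ ⟩ r →
              E* (while e loop sₜ) r r′ →
              EvalRule E E* (while e loop sₜ) σ r′
    loop-ff : ∀ {e sₜ σ} → σ ⊭ e →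
              EvalRule E E* (while e loop sₜ) σ ⟨ δ ⟨ ret σ ⟩ ⟩
    input   : ∀ {x σ} →
              EvalRule E E* (input x) σ ⟨ inp (λ v → ⟨ ret (σ [ x ↦ v ]) ⟩) ⟩
    output  : ∀ {e σ} →
              EvalRule E E* (output e) σ ⟨ out (⟦ e ⟧ σ) ⟨ ret σ ⟩ ⟩

  data ExtRule (E : EvalRel) (E* : ExtRel) : ExtRel where
    ret : ∀ {s σ r} → E s σ r → ExtRule E E* s ⟨ ret σ ⟩ r
    inp : ∀ {s f f′} → (∀ v → E* s (f v) (f′ v)) →
          ExtRule E E* s ⟨ inp f ⟩ ⟨ inp f′ ⟩
    out : ∀ {s v r r′} → E* s r r′ → ExtRule E E* s ⟨ out v r ⟩ ⟨ out v r′ ⟩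
    δ   : ∀ {s r r′} → E* s r r′ → ExtRule E E* s ⟨ δ r ⟩ ⟨ δ r′ ⟩

  record Supported (E : EvalRel) (E* : ExtRel) : Set₁ where
    field
      eval : ∀ {s σ r} → E s σ r → ∃[ r₁ ] r ≈ r₁ × EvalRule E E* s σ r₁
      ext  : ∀ {s r r′} → E* s r r′ →
             ∃₂ λ r₁ r₁′ → r ≈ r₁ × r′ ≈ r₁′ × ExtRule E E* s r₁ r₁′

  infix 4 _∣_⇒_ _∣_⇒ᵉˣᵗ_

  _∣_⇒_ : Stmt → State → Res → Set₂
  s ∣ σ ⇒ r = ∃₂ λ E E* → Supported E E* × E s σ r

  _∣_⇒ᵉˣᵗ_ : Stmt → Res → Res → Set₂
  s ∣ r ⇒ᵉˣᵗ r′ = ∃₂ λ E E* → Supported E E* × E* s r r′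

  ----------------------------------------------------------------------
  -- Classical-style resumptions

  data ResFᶜ (A : Set) : Set where
    ret : State → ResFᶜ A
    inp : (ℤ → A) → ResFᶜ A
    out : ℤ → A → ResFᶜ A
    •   : ResFᶜ A

  Resᶜ : Set
  Resᶜ = List ℤ → ResFᶜ ⊤

  observeᶜ : Resᶜ → ResFᶜ Resᶜ
  observeᶜ t with t []
  ... | ret σ   = ret σ
  ... | inp _   = inp (λ v p → t (v ∷ p))
  ... | out v _ = out v (λ p → t (0ℤ ∷ p))
  ... | •       = •

  ⟨_⟩ᶜ : ResFᶜ Resᶜ → Resᶜ
  ⟨ ret σ ⟩ᶜ   _       = ret σ
  ⟨ inp f ⟩ᶜ   []      = inp (λ _ → tt)
  ⟨ inp f ⟩ᶜ   (v ∷ p) = f v p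
  ⟨ out v r ⟩ᶜ []      = out v tt
  ⟨ out v r ⟩ᶜ (_ ∷ p) = r p
  ⟨ • ⟩ᶜ       _       = •

  data Bisimᶜ (R : Resᶜ → Resᶜ → Set) : ResFᶜ Resᶜ → ResFᶜ Resᶜ → Set where
    ret : ∀ {σ} → Bisimᶜ R (ret σ) (ret σ)
    inp : ∀ {f f*} → (∀ v → R (f v) (f* v)) → Bisimᶜ R (inp f) (inp f*)
    out : ∀ {v r r*} → R r r* → Bisimᶜ R (out v r) (out v r*)
    •   : Bisimᶜ R • •

  infix 4 _≈ᶜ_

  _≈ᶜ_ : Resᶜ → Resᶜ → Set₁
  r ≈ᶜ r* = ∃[ R ] (∀ {x y} → R x y → Bisimᶜ R (observeᶜ x) (observeᶜ y)) × R r r*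

  embStep : ResFᶜ Resᶜ → ResF Resᶜ
  embStep (ret σ)   = ret σ
  embStep (inp f)   = inp f
  embStep (out v r) = out v r
  embStep •         = δ ⟨ • ⟩ᶜ

  emb : Resᶜ → Res
  emb = unfold (λ r → embStep (observeᶜ r))

  ----------------------------------------------------------------------
  -- Classical-style big-step semantics

  -- Relations between pairs (statement, resumption) and resumptions.
  ExtRelᶜ : (ℓ : Level) → Set (lsuc ℓ)
  ExtRelᶜ ℓ = Stmt → Resᶜ → Resᶜ → Set ℓ

  infix 4 _⊆_

  _⊆_ : ∀ {ℓ ℓ′} → ExtRelᶜ ℓ → ExtRelᶜ ℓ′ → Set (ℓ ⊔ ℓ′)
  X ⊆ Y = ∀ {s r r′} → X s r r′ → Y s r r′

  Respects≈ : ∀ {ℓ} → ExtRelᶜ ℓ → Set (lsuc 0ℓ ⊔ ℓ)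
  Respects≈ X = ∀ {s r r₁ r′ r₁′} → r ≈ᶜ r₁ → r′ ≈ᶜ r₁′ → X s r r′ → X s r₁ r₁′

  infix 4 _⊢_∣_⇓_ _⊢_∣_⇑

  data _⊢_∣_⇓_ {ℓ} (X : ExtRelᶜ ℓ) : Stmt → State → Resᶜ → Set (lsuc 0ℓ ⊔ ℓ) where
    assign   : ∀ {x e σ} → X ⊢ x ≔ e ∣ σ ⇓ ⟨ ret (σ [ x ↦ ⟦ e ⟧ σ ]) ⟩ᶜ
    skip     : ∀ {σ} → X ⊢ skip ∣ σ ⇓ ⟨ ret σ ⟩ᶜ
    seq-ret  : ∀ {s₀ s₁ σ σ′ r} →
               X ⊢ s₀ ∣ σ ⇓ ⟨ ret σ′ ⟩ᶜ → X ⊢ s₁ ∣ σ′ ⇓ r →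
               X ⊢ s₀ ⨾ s₁ ∣ σ ⇓ r
    seq-inp  : ∀ {s₀ s₁ σ f f′} →
               X ⊢ s₀ ∣ σ ⇓ ⟨ inp f ⟩ᶜ → (∀ v → X s₁ (f v) (f′ v)) →
               X ⊢ s₀ ⨾ s₁ ∣ σ ⇓ ⟨ inp f′ ⟩ᶜ
    seq-out  : ∀ {s₀ s₁ σ v r r′} →
               X ⊢ s₀ ∣ σ ⇓ ⟨ out v r ⟩ᶜ → X s₁ r r′ →
               X ⊢ s₀ ⨾ s₁ ∣ σ ⇓ ⟨ out v r′ ⟩ᶜ
    if-tt    : ∀ {e sₜ s_f σ r} → σ ⊨ e → X ⊢ sₜ ∣ σ ⇓ r →
               X ⊢ if e then sₜ else s_f ∣ σ ⇓ r
    if-ff    : ∀ {e sₜ s_f σ r} → σ ⊭ e → X ⊢ s_f ∣ σ ⇓ r →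
               X ⊢ if e then sₜ else s_f ∣ σ ⇓ r
    loop-ret : ∀ {e sₜ σ σ′ r} → σ ⊨ e →
               X ⊢ sₜ ∣ σ ⇓ ⟨ ret σ′ ⟩ᶜ → X ⊢ while e loop sₜ ∣ σ′ ⇓ r →
               X ⊢ while e loop sₜ ∣ σ ⇓ r
    loop-inp : ∀ {e sₜ σ f f′} → σ ⊨ e →
               X ⊢ sₜ ∣ σ ⇓ ⟨ inp f ⟩ᶜ →
               (∀ v → X (while e loop sₜ) (f v) (f′ v)) →
               X ⊢ while e loop sₜ ∣ σ ⇓ ⟨ inp f′ ⟩ᶜ
    loop-out : ∀ {e sₜ σ v r r′} → σ ⊨ e →
               X ⊢ sₜ ∣ σ ⇓ ⟨ out v r ⟩ᶜ → X (while e loop sₜ) r r′ →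
               X ⊢ while e loop sₜ ∣ σ ⇓ ⟨ out v r′ ⟩ᶜ
    loop-ff  : ∀ {e sₜ σ} → σ ⊭ e → X ⊢ while e loop sₜ ∣ σ ⇓ ⟨ ret σ ⟩ᶜ
    input    : ∀ {x σ} → X ⊢ input x ∣ σ ⇓ ⟨ inp (λ v → ⟨ ret (σ [ x ↦ v ]) ⟩ᶜ) ⟩ᶜ
    output   : ∀ {e σ} → X ⊢ output e ∣ σ ⇓ ⟨ out (⟦ e ⟧ σ) ⟨ ret σ ⟩ᶜ ⟩ᶜ
    resp     : ∀ {s σ r r₁} → r ≈ᶜ r₁ → X ⊢ s ∣ σ ⇓ r₁ → X ⊢ s ∣ σ ⇓ r

  data DivRule {ℓ} (X : ExtRelᶜ ℓ) (D : Stmt → State → Set₁) :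
               Stmt → State → Set (lsuc 0ℓ ⊔ ℓ) where
    seq-left  : ∀ {s₀ s₁ σ} → D s₀ σ → DivRule X D (s₀ ⨾ s₁) σ
    seq-right : ∀ {s₀ s₁ σ σ′} → X ⊢ s₀ ∣ σ ⇓ ⟨ ret σ′ ⟩ᶜ → D s₁ σ′ →
                DivRule X D (s₀ ⨾ s₁) σ
    if-tt     : ∀ {e sₜ s_f σ} → σ ⊨ e → D sₜ σ →
                DivRule X D (if e then sₜ else s_f) σ
    if-ff     : ∀ {e sₜ s_f σ} → σ ⊭ e → D s_f σ →
                DivRule X D (if e then sₜ else s_f) σ
    loop-body : ∀ {e sₜ σ} → σ ⊨ e → D sₜ σ → DivRule X D (while e loop sₜ) σ
    loop-iter : ∀ {e sₜ σ σ′} → σ ⊨ e → X ⊢ sₜ ∣ σ ⇓ ⟨ ret σ′ ⟩ᶜ →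
                D (while e loop sₜ) σ′ → DivRule X D (while e loop sₜ) σ

  _⊢_∣_⇑ : ∀ {ℓ} → ExtRelᶜ ℓ → Stmt → State → Set (lsuc (lsuc 0ℓ) ⊔ ℓ)
  X ⊢ s ∣ σ ⇑ = ∃[ D ] (∀ {s₁ σ₁} → D s₁ σ₁ → DivRule X D s₁ σ₁) × D s σ

  data ExtRuleᶜ (R : ExtRelᶜ (lsuc 0ℓ)) : Stmt → Resᶜ → Resᶜ → Set₂ where
    ret-⇓ : ∀ {s σ r} (X : ExtRelᶜ (lsuc 0ℓ)) → Respects≈ X → X ⊆ R →
            X ⊢ s ∣ σ ⇓ r → ExtRuleᶜ R s ⟨ ret σ ⟩ᶜ r
    ret-⇑ : ∀ {s σ} (X : ExtRelᶜ (lsuc 0ℓ)) → Respects≈ X → X ⊆ R →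
            X ⊢ s ∣ σ ⇑ → ExtRuleᶜ R s ⟨ ret σ ⟩ᶜ ⟨ • ⟩ᶜ
    inp   : ∀ {s f f′} → (∀ v → R s (f v) (f′ v)) →
            ExtRuleᶜ R s ⟨ inp f ⟩ᶜ ⟨ inp f′ ⟩ᶜ
    out   : ∀ {s v r r′} → R s r r′ → ExtRuleᶜ R s ⟨ out v r ⟩ᶜ ⟨ out v r′ ⟩ᶜ
    •     : ∀ {s} → ExtRuleᶜ R s ⟨ • ⟩ᶜ ⟨ • ⟩ᶜ

  infix 4 _∣_⇒*_ _∣_⇒ᶜ_

  _∣_⇒*_ : Stmt → Resᶜ → Resᶜ → Set₂
  s ∣ r ⇒* r′ = ∃[ R ]
    (∀ {s₁ x y} → R s₁ x y →
       ∃₂ λ x₁ y₁ → x ≈ᶜ x₁ × y ≈ᶜ y₁ × ExtRuleᶜ R s₁ x₁ y₁) ×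
    R s r r′

  data _∣_⇒ᶜ_ (s : Stmt) (σ : State) : Resᶜ → Set₂ where
    converges : ∀ {r} → _∣_⇒*_ ⊢ s ∣ σ ⇓ r → s ∣ σ ⇒ᶜ r
    diverges  : ∀ {r} → r ≈ᶜ ⟨ • ⟩ᶜ → _∣_⇒*_ ⊢ s ∣ σ ⇑ → s ∣ σ ⇒ᶜ r

{-# OPTIONS --safe #-}

-- Truth of guards is decidable, so the delayful semantics is computed by an
-- abstract machine: a configuration is a stack of statements with a state,
-- and its run is a resumption.  A classical derivation of (s, σ) ⇒ᶜ r never
-- has to be turned into a delayful one; it only has to tell how many delays
-- the machine makes before its next visible action (⇓), or that it makes
-- arbitrarily many (⇑).
--
-- The resulting relation between classical resumptions and configurations
-- lives in Set₂, whereas _≅_ asks for a Set₁-valued relation.  It is replaced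
-- by the set of its nodes, which are indexed by the paths of visible actions
-- from the root.

module Submission where

open import Data.Bool.Base using (true; false; if_then_else_)
open import Data.Integer.Base using (ℤ; 0ℤ)
import Data.Integer.Properties as ℤ
open import Data.List.Base using (List; []; _∷_; _++_)
open import Data.Nat.Base using (ℕ; zero; suc)
open import Data.Product.Base using (_×_; _,_; ∃-syntax; ∃₂)
open import Function.Base using (_∘_; flip)
open import Level using (Level; 0ℓ; Lift; lift) renaming (suc to lsuc)
open import Relation.Binary.PropositionalEquality
  using (_≡_; refl; sym; trans; cong; _≗_)
open import Relation.Nullary.Decidable
  using (Dec; yes; no; does; ¬?; dec-true; dec-false)
open import Defs

module Soundness (L : Language) where

  open Semantics L renaming (if_then_else_ to If_Then_Else_)

  -- Resumptions

  map : ∀ {A B : Set} → (A → B) → ResF A → ResF B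
  map f (ret σ)   = ret σ
  map f (inp g)   = inp (f ∘ g)
  map f (out v x) = out v (f x)
  map f (δ x)     = δ (f x)

  ≗⇒Bisim : ∀ {x y : Res} → x ≗ y → Bisim _≗_ (observe x) (observe y)
  ≗⇒Bisim {x} {y} x≗y with x [] | y [] | x≗y []
  ... | ret _   | _ | refl = ret
  ... | inp _   | _ | refl = inp λ v p → x≗y (v ∷ p)
  ... | out _ _ | _ | refl = out λ p → x≗y (0ℤ ∷ p)
  ... | δ _     | _ | refl = δ λ p → x≗y (0ℤ ∷ p)

  ≗⇒≈ : ∀ {x y : Res} → x ≗ y → x ≈ y
  ≗⇒≈ x≗y = _≗_ , ≗⇒Bisim , x≗y

  ≈-refl : ∀ {x} → x ≈ x
  ≈-refl = ≗⇒≈ λ _ → refl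

  module _ {A : Set} (c : A → ResF A) where

    unfoldStep-≗ : ∀ d → unfoldStep c d ≗ ⟨ map (unfold c) d ⟩
    unfoldStep-≗ (ret _)   _       = refl
    unfoldStep-≗ (inp _)   []      = refl
    unfoldStep-≗ (inp _)   (_ ∷ _) = refl
    unfoldStep-≗ (out _ _) []      = refl
    unfoldStep-≗ (out _ _) (_ ∷ _) = refl
    unfoldStep-≗ (δ _)     []      = refl
    unfoldStep-≗ (δ _)     (_ ∷ _) = refl

    unfold-≈ : ∀ x {d} → c x ≡ d → unfold c x ≈ ⟨ map (unfold c) d ⟩
    unfold-≈ _ {d} refl = ≗⇒≈ (unfoldStep-≗ d)

  ≈ᶜ-sym : ∀ {x y} → x ≈ᶜ y → y ≈ᶜ x
  ≈ᶜ-sym (R , supp , h) = flip R , Bisimᶜ-sym ∘ supp , h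
    where
    Bisimᶜ-sym : ∀ {R x y} → Bisimᶜ R x y → Bisimᶜ (flip R) y x
    Bisimᶜ-sym ret     = ret
    Bisimᶜ-sym (inp h) = inp h
    Bisimᶜ-sym (out h) = out h
    Bisimᶜ-sym •       = •

  -- The abstract machine

  Config : Set
  Config = List Stmt × State

  ⊨? : ∀ σ e → Dec (σ ⊨ e)
  ⊨? σ e = ¬? (⟦ e ⟧ σ ℤ.≟ 0ℤ)

  module _ {A : Set} where

    branch : Expr → State → A → A → A
    branch e σ x y = if does (⊨? σ e) then x else y

    branch-tt : ∀ {e σ} {x y : A} → σ ⊨ e → branch e σ x y ≡ x
    branch-tt {e} {σ} h rewrite dec-true (⊨? σ e) h = refl

    branch-ff : ∀ {e σ} {x y : A} → σ ⊭ e → branch e σ x y ≡ y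
    branch-ff {e} {σ} h rewrite dec-false (⊨? σ e) h = refl

  branch-map : ∀ {A B : Set} (f : A → B) {e σ x y} →
               branch e σ (f x) (f y) ≡ f (branch e σ x y)
  branch-map f {e} {σ} with does (⊨? σ e)
  ... | true  = refl
  ... | false = refl

  -- stepBefore s k next steps s with the stack k below it; next steps k, and
  -- is called when s terminates without any action.
  stepBefore : Stmt → List Stmt → (State → ResF Config) → State → ResF Config
  stepBefore skip                  k next σ = next σ
  stepBefore (s₀ ⨾ s₁)             k next σ =
    stepBefore s₀ (s₁ ∷ k) (stepBefore s₁ k next) σ
  stepBefore (x ≔ e)               k next σ = δ (k , σ [ x ↦ ⟦ e ⟧ σ ])
  stepBefore (If e Then sₜ Else s_f) k next σ = δ (branch e σ (sₜ ∷ k) (s_f ∷ k) , σ)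
  stepBefore (while e loop sₜ)     k next σ =
    δ (branch e σ (sₜ ∷ (while e loop sₜ) ∷ k) k , σ)
  stepBefore (input x)             k next σ = inp λ v → k , σ [ x ↦ v ]
  stepBefore (output e)            k next σ = out (⟦ e ⟧ σ) (k , σ)

  -- `skip` and `⨾` take no step of their own, so one step may look through several statements; the
  -- continuation argument of `stepBefore` keeps this search structurally recursive.
  stepStack : List Stmt → State → ResF Config
  stepStack []      σ = ret σ
  stepStack (s ∷ k) σ = stepBefore s k (stepStack k) σ

  step : Config → ResF Config
  step (k , σ) = stepStack k σ

  run : Config → Res
  run = unfold step

  runStep : ResF Config → Res
  runStep = unfoldStep step

  start : Stmt → State → Config
  start s σ = s ∷ [] , σ

  push : Stmt → Config → Config
  push t (k , σ) = k ++ t ∷ [] , σ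

  -- When the machine stops in `σ`, `t` starts there without a delay, as the rule `ret` of extended
  -- evaluation requires.
  bind : Stmt → ResF Config → ResF Config
  bind t (ret σ)   = step (start t σ)
  bind t (inp g)   = inp (push t ∘ g)
  bind t (out v c) = out v (push t c)
  bind t (δ c)     = δ (push t c)

  -- The hypothesis speaks of arbitrary continuations, so that for a sequence the induction
  -- hypothesis of `s₁` can discharge it.
  stepBefore-push : ∀ t s k {next next′} → (∀ σ → next′ σ ≡ bind t (next σ)) →
                    ∀ σ → stepBefore s (k ++ t ∷ []) next′ σ ≡
                          bind t (stepBefore s k next σ)
  stepBefore-push t skip k h σ = h σ
  stepBefore-push t (s₀ ⨾ s₁) k h σ =
    stepBefore-push t s₀ (s₁ ∷ k) (stepBefore-push t s₁ k h) σ
  stepBefore-push t (x ≔ e) k h σ = refl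
  stepBefore-push t (If e Then sₜ Else s_f) k h σ =
    cong (λ k → δ (k , σ)) (branch-map (_++ t ∷ []) {e} {σ})
  stepBefore-push t (while e loop sₜ) k h σ =
    cong (λ k → δ (k , σ)) (branch-map (_++ t ∷ []) {e} {σ})
  stepBefore-push t (input x) k h σ = refl
  stepBefore-push t (output e) k h σ = refl

  stepStack-push : ∀ t k σ → stepStack (k ++ t ∷ []) σ ≡ bind t (stepStack k σ)
  stepStack-push t []      σ = refl
  stepStack-push t (s ∷ k) σ = stepBefore-push t s k (stepStack-push t k) σ

  step-push : ∀ t {c d} → step c ≡ d → step (push t c) ≡ bind t d
  step-push t {k , σ} refl = stepStack-push t k σ

  if-step-tt : ∀ {e sₜ s_f σ} → σ ⊨ e →
               step (start (If e Then sₜ Else s_f) σ) ≡ δ (start sₜ σ)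
  if-step-tt {e} {σ = σ} h = cong (λ k → δ (k , σ)) (branch-tt {e = e} {σ} h)

  if-step-ff : ∀ {e sₜ s_f σ} → σ ⊭ e →
               step (start (If e Then sₜ Else s_f) σ) ≡ δ (start s_f σ)
  if-step-ff {e} {σ = σ} h = cong (λ k → δ (k , σ)) (branch-ff {e = e} {σ} h)

  loop-step-tt : ∀ {e sₜ σ} → σ ⊨ e →
                 step (start (while e loop sₜ) σ) ≡
                 δ (push (while e loop sₜ) (start sₜ σ))
  loop-step-tt {e} {σ = σ} h = cong (λ k → δ (k , σ)) (branch-tt {e = e} {σ} h)

  loop-step-ff : ∀ {e sₜ σ} → σ ⊭ e →
                 step (start (while e loop sₜ) σ) ≡ δ ([] , σ)
  loop-step-ff {e} {σ = σ} h = cong (λ k → δ (k , σ)) (branch-ff {e = e} {σ} h)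

  -- The machine implements the delayful semantics

  Evaluates : EvalRel
  Evaluates s σ r = Lift (lsuc 0ℓ) (r ≗ run (start s σ))

  -- The witness is a step outcome, not a configuration, because
  -- ⟨ δ ⟨ ret σ ⟩ ⟩ need not be the run of a configuration.
  Extends : ExtRel
  Extends s r r′ =
    Lift (lsuc 0ℓ) (∃[ d ] (r ≗ runStep d × r′ ≗ runStep (bind s d)))

  delay-ret-≗ : ∀ {σ} → ⟨ δ ⟨ ret σ ⟩ ⟩ ≗ runStep (δ ([] , σ))
  delay-ret-≗ []      = refl
  delay-ret-≗ (_ ∷ _) = refl

  Extends-delay : ∀ {s σ} → Extends s ⟨ δ ⟨ ret σ ⟩ ⟩ (runStep (δ (start s σ)))
  Extends-delay {σ = σ} = lift (δ ([] , σ) , delay-ret-≗ , λ _ → refl)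

  run-push-≗ : ∀ t {c d} → step c ≡ d → run (push t c) ≗ runStep (bind t d)
  run-push-≗ t {c} eq p = cong (λ d → runStep d p) (step-push t {c} eq)

  Extends-run : ∀ {t} c → Extends t (run c) (run (push t c))
  Extends-run {t} c = lift (step c , (λ _ → refl) , run-push-≗ t {c} refl)

  Evaluates-rule : ∀ s σ → ∃[ r ] (run (start s σ) ≗ r × EvalRule Evaluates Extends s σ r)
  Evaluates-rule skip σ = _ , (λ _ → refl) , skip
  Evaluates-rule (s₀ ⨾ s₁) σ =
    _ , (λ _ → refl) ,
    seq (lift λ _ → refl) (Extends-run (start s₀ σ))
  Evaluates-rule (x ≔ e) σ = _ , (λ p → sym (delay-ret-≗ p)) , assign
  Evaluates-rule (If e Then sₜ Else s_f) σ with ⊨? σ e in eq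
  ... | yes h = _ , (λ p → cong (λ d → runStep d p) (if-step-tt {e} {sₜ} {s_f} h)) ,
                if-tt h Extends-delay
  ... | no h  = _ , (λ p → cong (λ d → runStep d p) (if-step-ff {e} {sₜ} {s_f} h)) ,
                if-ff h Extends-delay
  Evaluates-rule (while e loop sₜ) σ with ⊨? σ e
  ... | yes h = _ , (λ p → cong (λ d → runStep d p) (loop-step-tt {e} {sₜ} h)) ,
                -- The body's resumption is `runStep (δ (start sₜ σ))`; binding the loop to this
                -- outcome gives the loop's own first step.
                loop-tt h Extends-delay (lift (δ (start sₜ σ) , (λ _ → refl) , λ _ → refl))
  ... | no h  = _ , (λ p → trans (cong (λ d → runStep d p) (loop-step-ff {e} {sₜ} h))
                                 (sym (delay-ret-≗ p))) ,
                loop-ff h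
  Evaluates-rule (input x) σ = _ , lemma , input
    where
    lemma : run (start (input x) σ) ≗ ⟨ inp (λ v → ⟨ ret (σ [ x ↦ v ]) ⟩) ⟩
    lemma []      = refl
    lemma (_ ∷ _) = refl
  Evaluates-rule (output e) σ = _ , lemma , output
    where
    lemma : run (start (output e) σ) ≗ ⟨ out (⟦ e ⟧ σ) ⟨ ret σ ⟩ ⟩
    lemma []      = refl
    lemma (_ ∷ _) = refl

  Extends-rule : ∀ t d → ∃₂ λ r r′ → runStep d ≗ r × runStep (bind t d) ≗ r′ ×
                 ExtRule Evaluates Extends t r r′
  Extends-rule t (ret σ) =
    _ , _ , (λ _ → refl) , (λ _ → refl) , ret (lift λ _ → refl)
  Extends-rule t (inp g) =
    _ , _ , unfoldStep-≗ step (inp g) , unfoldStep-≗ step (inp (push t ∘ g)) ,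
    inp λ v → Extends-run (g v)
  Extends-rule t (out v c) =
    _ , _ , unfoldStep-≗ step (out v c) , unfoldStep-≗ step (out v (push t c)) ,
    out (Extends-run c)
  Extends-rule t (δ c) =
    _ , _ , unfoldStep-≗ step (δ c) , unfoldStep-≗ step (δ (push t c)) ,
    δ (Extends-run c)

  run-supported : Supported Evaluates Extends
  Supported.eval run-supported {s} {σ} (lift h) =
    let r₁ , h₁ , rule = Evaluates-rule s σ
    in  r₁ , ≗⇒≈ (λ p → trans (h p) (h₁ p)) , rule
  Supported.ext run-supported {s} (lift (d , h , h′)) =
    let r₁ , r₁′ , h₁ , h₁′ , rule = Extends-rule s d
    in  r₁ , r₁′ , ≗⇒≈ (λ p → trans (h p) (h₁ p)) ,
        ≗⇒≈ (λ p → trans (h′ p) (h₁′ p)) , rule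

  ⇒-run : ∀ s σ → s ∣ σ ⇒ run (start s σ)
  ⇒-run s σ = Evaluates , Extends , run-supported , lift λ _ → refl

  -- Delays of the machine

  infix 4 _⇝_ _↑_

  -- The target is an outcome, so `c ⇝ step c₁` lets `c` come to behave like `c₁` although the
  -- stacks differ, as those of `s₀ ⨾ s₁` and of `s₀` above `s₁` do.
  data _⇝_ : Config → ResF Config → Set where
    here  : ∀ {c d} → step c ≡ d → c ⇝ d
    later : ∀ {c c′ d} → step c ≡ δ c′ → c′ ⇝ d → c ⇝ d

  data _↑_ : Config → ℕ → Set where
    zero : ∀ {c} → c ↑ zero
    suc  : ∀ {c c′ n} → step c ≡ δ c′ → c′ ↑ n → c ↑ suc n

  ⇝-delay : ∀ {c c′} → step c ≡ δ c′ → c ⇝ step c′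
  ⇝-delay eq = later eq (here refl)

  ⇝-trans : ∀ {c c₁ d} → c ⇝ step c₁ → c₁ ⇝ d → c ⇝ d
  ⇝-trans (here eq)     (here eq₁)    = here (trans eq eq₁)
  ⇝-trans (here eq)     (later eq₁ q) = later (trans eq eq₁) q
  ⇝-trans (later eq p)  q             = later eq (⇝-trans p q)

  ⇝-push : ∀ t {c d} → c ⇝ d → push t c ⇝ bind t d
  ⇝-push t {c} (here eq)    = here (step-push t {c} eq)
  ⇝-push t {c} (later eq p) = later (step-push t {c} eq) (⇝-push t p)

  ↑-pred : ∀ {c n} → c ↑ suc n → c ↑ n
  ↑-pred {n = zero}  (suc eq p) = zero
  ↑-pred {n = suc n} (suc eq p) = suc eq (↑-pred p)

  ⇝-↑ : ∀ {c c₁ n} → c ⇝ step c₁ → c₁ ↑ n → c ↑ n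
  ⇝-↑ (here eq)    zero        = zero
  ⇝-↑ (here eq)    (suc eq₁ q) = suc (trans eq eq₁) q
  -- The delay passed here is one more than claimed; since `↑` is only a lower bound, it may be
  -- dropped.
  ⇝-↑ (later eq p) q           = ↑-pred (suc eq (⇝-↑ p q))

  ↑-push : ∀ t {c n} → c ↑ n → push t c ↑ n
  ↑-push t     zero       = zero
  ↑-push t {c} (suc eq p) = suc (step-push t {c} eq) (↑-push t p)

  -- Classical resumptions against configurations

  data Match {ℓ} (B : Resᶜ → Config → Set ℓ) : ResFᶜ Resᶜ → Config → Set ℓ where
    ret : ∀ {c σ} → c ⇝ ret σ → Match B (ret σ) c
    inp : ∀ {c f g} → c ⇝ inp g → (∀ v → B (f v) (g v)) → Match B (inp f) c
    out : ∀ {c v r c′} → c ⇝ out v c′ → B r c′ → Match B (out v r) c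
    •   : ∀ {c} → (∀ n → c ↑ n) → Match B • c

  Match-⇝ : ∀ {ℓ} {B : Resᶜ → Config → Set ℓ} {d c c₁} → c ⇝ step c₁ →
            Match B d c₁ → Match B d c
  Match-⇝ p (ret q)   = ret (⇝-trans p q)
  Match-⇝ p (inp q b) = inp (⇝-trans p q) b
  Match-⇝ p (out q b) = out (⇝-trans p q) b
  Match-⇝ p (• h)     = • λ n → ⇝-↑ p (h n)

  -- Having ext as a constructor makes the relation closed under sequencing
  -- below an input or output, where the classical rules give no derivation
  -- for the composite statement.
  data Describes : Resᶜ → Config → Set₂ where
    done : ∀ {σ} → Describes ⟨ ret σ ⟩ᶜ ([] , σ)
    ext  : ∀ {t r r′ c} → Describes r c → t ∣ r ⇒* r′ → Describes r′ (push t c)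
    resp : ∀ {r r₁ c} → r ≈ᶜ r₁ → Describes r₁ c → Describes r c

  Matches : Resᶜ → Config → Set₂
  Matches r c = Match Describes (observeᶜ r) c

  Matches-resp : ∀ {r r₁ c} → r ≈ᶜ r₁ → Matches r₁ c → Matches r c
  Matches-resp (R , supp , h) = transport (supp h)
    where
    transport : ∀ {d d₁ c} → Bisimᶜ R d d₁ → Match Describes d₁ c → Match Describes d c
    transport ret     (ret p)   = ret p
    transport (inp h) (inp p b) = inp p λ v → resp (R , supp , h v) (b v)
    transport (out h) (out p b) = out p (resp (R , supp , h) b)
    transport •       (• h)     = • h

  module _ {ℓ : Level} {X : ExtRelᶜ ℓ} (X⊆⇒* : X ⊆ _∣_⇒*_) where

    -- The induction is on the finite derivation; its premises in `X` are stored as `ext` at the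
    -- children instead of being unfolded. `X` and its level are free because both `⇒*` and smaller
    -- relations inside it are used.
    ⇓⇒Matches : ∀ {s σ r} → X ⊢ s ∣ σ ⇓ r → Matches r (start s σ)

    ⇓-ret⇒⇝ : ∀ {t s σ σ′} → X ⊢ s ∣ σ ⇓ ⟨ ret σ′ ⟩ᶜ →
              push t (start s σ) ⇝ step (start t σ′)
    ⇓-ret⇒⇝ {t} p with ⇓⇒Matches p
    ... | ret q = ⇝-push t q

    ⇓-inp⇒Matches : ∀ {t s σ f f′} → X ⊢ s ∣ σ ⇓ ⟨ inp f ⟩ᶜ →
                    (∀ v → X t (f v) (f′ v)) →
                    Matches ⟨ inp f′ ⟩ᶜ (push t (start s σ))
    ⇓-inp⇒Matches {t} p x with ⇓⇒Matches p
    ... | inp q b = inp (⇝-push t q) λ v → ext (b v) (X⊆⇒* (x v))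

    ⇓-out⇒Matches : ∀ {t s σ v r r′} → X ⊢ s ∣ σ ⇓ ⟨ out v r ⟩ᶜ → X t r r′ →
                    Matches ⟨ out v r′ ⟩ᶜ (push t (start s σ))
    ⇓-out⇒Matches {t} p x with ⇓⇒Matches p
    ... | out q b = out (⇝-push t q) (ext b (X⊆⇒* x))

    ⇓⇒Matches assign = ret (later refl (here refl))
    ⇓⇒Matches skip = ret (here refl)
    ⇓⇒Matches (seq-ret p q) =
      Match-⇝ (here refl) (Match-⇝ (⇓-ret⇒⇝ p) (⇓⇒Matches q))
    ⇓⇒Matches (seq-inp p x) = Match-⇝ (here refl) (⇓-inp⇒Matches p x)
    ⇓⇒Matches (seq-out p x) = Match-⇝ (here refl) (⇓-out⇒Matches p x)
    ⇓⇒Matches (if-tt h p) = Match-⇝ (⇝-delay (if-step-tt h)) (⇓⇒Matches p)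
    ⇓⇒Matches (if-ff h p) = Match-⇝ (⇝-delay (if-step-ff h)) (⇓⇒Matches p)
    ⇓⇒Matches (loop-ret h p q) =
      Match-⇝ (⇝-delay (loop-step-tt h)) (Match-⇝ (⇓-ret⇒⇝ p) (⇓⇒Matches q))
    ⇓⇒Matches (loop-inp h p x) =
      Match-⇝ (⇝-delay (loop-step-tt h)) (⇓-inp⇒Matches p x)
    ⇓⇒Matches (loop-out h p x) =
      Match-⇝ (⇝-delay (loop-step-tt h)) (⇓-out⇒Matches p x)
    ⇓⇒Matches (loop-ff h) = ret (⇝-delay (loop-step-ff h))
    ⇓⇒Matches input = inp (here refl) λ _ → done
    ⇓⇒Matches output = out (here refl) done
    ⇓⇒Matches (resp r≈r₁ p) = Matches-resp r≈r₁ (⇓⇒Matches p)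

    -- The recursion is lexicographic in `n` and the statement: a sequence yields no delay of its
    -- own but passes to a smaller statement, while conditionals and loops yield a delay and so
    -- lower `n`.
    ⇑⇒↑ : ∀ {s σ} → X ⊢ s ∣ σ ⇑ → ∀ n → start s σ ↑ n
    ⇑⇒↑ (D , supp , d) n = delays n _ d
      where
      delays  : ∀ n s {σ} → D s σ → start s σ ↑ n
      delays′ : ∀ n s {σ} → DivRule X D s σ → start s σ ↑ n

      delays n s d = delays′ n s (supp d)

      delays′ n (s₀ ⨾ s₁) (seq-left d) =
        ⇝-↑ (here refl) (↑-push s₁ (delays n s₀ d))
      delays′ n (s₀ ⨾ s₁) (seq-right p d) =
        ⇝-↑ (here refl) (⇝-↑ (⇓-ret⇒⇝ p) (delays n s₁ d))
      delays′ zero    _ _ = zero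
      delays′ (suc n) _ (if-tt h d) = suc (if-step-tt h) (delays n _ d)
      delays′ (suc n) _ (if-ff h d) = suc (if-step-ff h) (delays n _ d)
      delays′ (suc n) _ (loop-body h d) =
        suc (loop-step-tt h) (↑-push _ (delays n _ d))
      delays′ (suc n) _ (loop-iter h p d) =
        suc (loop-step-tt h) (⇝-↑ (⇓-ret⇒⇝ p) (delays n _ d))

  -- Once `c` stops in `σ`, `push t c` behaves like `start t σ`, so the derivation for `t` takes
  -- over; if `c` acts visibly first, `t` waits in an `ext` below the action.
  ExtRuleᶜ⇒Matches : ∀ {R t r r′ c} → R ⊆ _∣_⇒*_ → ExtRuleᶜ R t r r′ →
                     Matches r c → Matches r′ (push t c)
  ExtRuleᶜ⇒Matches {t = t} R⊆⇒* (ret-⇓ X _ X⊆R p) (ret q) =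
    Match-⇝ (⇝-push t q) (⇓⇒Matches (R⊆⇒* ∘ X⊆R) p)
  ExtRuleᶜ⇒Matches {t = t} R⊆⇒* (ret-⇑ X _ X⊆R p) (ret q) =
    • λ n → ⇝-↑ (⇝-push t q) (⇑⇒↑ (R⊆⇒* ∘ X⊆R) p n)
  ExtRuleᶜ⇒Matches {t = t} R⊆⇒* (inp x) (inp q b) =
    inp (⇝-push t q) λ v → ext (b v) (R⊆⇒* (x v))
  ExtRuleᶜ⇒Matches {t = t} R⊆⇒* (out x) (out q b) =
    out (⇝-push t q) (ext b (R⊆⇒* x))
  ExtRuleᶜ⇒Matches {t = t} R⊆⇒* • (• h) = • λ n → ↑-push t (h n)

  -- Only the root is exposed: nested `ext` are peeled off by induction, while children remain under
  -- `Describes`. The witness `R` lies within `⇒*` because it is supported.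
  Describes⇒Matches : ∀ {r c} → Describes r c → Matches r c
  Describes⇒Matches done = ret (here refl)
  Describes⇒Matches (resp r≈r₁ b) = Matches-resp r≈r₁ (Describes⇒Matches b)
  Describes⇒Matches (ext b (R , supp , x)) =
    let _ , _ , r≈r₁ , r′≈r₁′ , rule = supp x
    in  Matches-resp r′≈r₁′
          (ExtRuleᶜ⇒Matches (λ y → R , supp , y) rule
            (Matches-resp (≈ᶜ-sym r≈r₁) (Describes⇒Matches b)))

  ⇒ᶜ⇒Matches : ∀ {s σ r} → s ∣ σ ⇒ᶜ r → Matches r (start s σ)
  ⇒ᶜ⇒Matches (converges p)    = ⇓⇒Matches (λ x → x) p
  ⇒ᶜ⇒Matches (diverges r≈• p) = Matches-resp r≈• (• (⇑⇒↑ (λ x → x) p))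

  -- Weak bisimilarity

  ⇝⇒↓ : ∀ {c d r} → c ⇝ d → ⟨ map run d ⟩ ↓ r → run c ↓ r
  ⇝⇒↓ {c} (here eq)    h = resp (unfold-≈ step c eq) ≈-refl h
  ⇝⇒↓ {c} (later eq p) h = resp (unfold-≈ step c eq) ≈-refl (δ (⇝⇒↓ p h))

  emb-≈ : ∀ r {d} → observeᶜ r ≡ d → emb r ≈ ⟨ map emb (embStep d) ⟩
  emb-≈ r eq = unfold-≈ (λ r → embStep (observeᶜ r)) r (cong embStep eq)

  record Node : Set₂ where
    constructor node
    field
      {resumption} : Resᶜ
      {config}     : Config
      matches      : Matches resumption config

  open Node

  -- At a leaf the child is the junk value given as default.
  childOf : ∀ {d c} → Match Describes d c → (default : Node) → ℤ → Node
  childOf (ret _)   n v = n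
  childOf (inp _ b) n v = node (Describes⇒Matches (b v))
  childOf (out _ b) n v = node (Describes⇒Matches b)
  childOf (• _)     n v = n

  child : Node → ℤ → Node
  child n = childOf (matches n) n

  module _ (root : Node) where

    -- The most recent action is at the head of the path.
    nodeAt : List ℤ → Node
    nodeAt []      = root
    nodeAt (v ∷ p) = child (nodeAt p) v

    -- A divergent node has no genuine child, yet weak bisimilarity consumes its delays one at a
    -- time; `divergent` covers every configuration met on the way.
    data Related : Res → Res → Set₁ where
      visible   : ∀ p → Related (emb (resumption (nodeAt p))) (run (config (nodeAt p)))
      divergent : ∀ {c} → (∀ n → c ↑ n) → Related (emb ⟨ • ⟩ᶜ) (run c)

    WeakBisimUpTo : Res → Res → Set₁
    WeakBisimUpTo x y =
      ∃₂ λ x₁ y₁ → x ≈ x₁ × y ≈ y₁ × WeakBisim Related x₁ y₁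

    divergent-supported : ∀ r {c} → observeᶜ r ≡ • → (∀ n → c ↑ n) →
                          WeakBisimUpTo (emb r) (run c)
    divergent-supported r {c} eq h with h 1
    ... | suc {c′ = c′} eq₁ _ =
      _ , _ , emb-≈ r eq , unfold-≈ step c eq₁ , δ (divergent λ n → tail (h (suc n)))
      where
      δ-injective : ∀ {c₁ c₂ : Config} → ResF.δ c₁ ≡ δ c₂ → c₁ ≡ c₂
      δ-injective refl = refl

      -- `h 1` fixes the successor `c′`; as `step` is a function, the first delay in every
      -- `h (suc n)` leads to the same configuration.
      tail : ∀ {n} → c ↑ suc n → c′ ↑ n
      tail (suc eq₂ q) with refl ← δ-injective (trans (sym eq₁) eq₂) = q

    match-supported : ∀ {r d c n} → observeᶜ r ≡ d → (m : Match Describes d c) →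
      (∀ v → Related (emb (resumption (childOf m n v))) (run (config (childOf m n v)))) →
      WeakBisimUpTo (emb r) (run c)
    match-supported {r} eq (ret q) _ =
      _ , _ , ≈-refl , ≈-refl , ret (resp (emb-≈ r eq) ≈-refl ret) (⇝⇒↓ q ret)
    match-supported {r} eq (inp q b) h =
      _ , _ , ≈-refl , ≈-refl ,
      inp (resp (emb-≈ r eq) ≈-refl (inp λ _ → ≈-refl)) (⇝⇒↓ q (inp λ _ → ≈-refl)) h
    match-supported {r} eq (out q b) h =
      _ , _ , ≈-refl , ≈-refl ,
      -- Below an output every label leads to the same child; `0ℤ` is an arbitrary choice.
      out (resp (emb-≈ r eq) ≈-refl (out ≈-refl)) (⇝⇒↓ q (out ≈-refl)) (h 0ℤ)
    match-supported {r} eq (• h) _ = divergent-supported r eq h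

    Related-supported : ∀ {x y} → Related x y → WeakBisimUpTo x y
    Related-supported (visible p) =
      match-supported refl (matches (nodeAt p)) λ v → visible (v ∷ p)
    Related-supported (divergent h) = divergent-supported ⟨ • ⟩ᶜ refl h

  Matches⇒≅ : ∀ {r c} → Matches r c → emb r ≅ run c
  Matches⇒≅ m = Related (node m) , Related-supported (node m) , visible []

proposition7p1 : (L : Language) → let open Semantics L in
    ∀ (s : Stmt) (σ : State) (r : Resᶜ) → s ∣ σ ⇒ᶜ r →
    ∃[ r′ ] s ∣ σ ⇒ r′ × emb r ≅ r′
proposition7p1 L s σ r h =
  run (start s σ) , ⇒-run s σ , Matches⇒≅ (⇒ᶜ⇒Matches h)
  where open Soundness L
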